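{- Let $D=(V,A)$ be a finite connected monotone bipartite digraph; that is, $V$ is the disjoint union of nonempty sets $V_1,V_2$ and every arc $(u,v)\in A$ satisfies $u\in V_1$ and $v\in V_2$. Then $$\eta_t(D)=\max\left\{\left\lfloor\frac{d(u)}{d(v)}\right\rfloor+1 : v\in V_2,\ u\in N(v)\right\}.$$
   Context: For a directed acyclic graph $D=(V,A)$, $N(v)$ denotes the set of neighbors of $v$ in the undirected underlying graph of $D$ (both in- and out-neighbors), and $d(v)=|N(v)|$. $\mathbb{N}$ denotes the positive integers. For a labeling $f:V\to\mathbb{N}$, put $S(v)=\sum_{w\in N(v)}f(w)$. The labeling $f$ is a topological additive numbering of $D$ if $S(u)<S(v)$ for every $(u,v)\in A$; it is a topological additive $k$-numbering if moreover $k$ is the largest label used in $f$. If $D$ has at least one topological additive numbering, $\eta_t(D)$ is the least $k$ for which $D$ has a topological additive $k$-numbering; the assertion includes that $\eta_t(D)$ is defined, i.e. that $D$ has a topological additive numbering. -}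

module Defs where

open import Data.Fin.Base using (Fin)
open import Data.Fin.Subset using (Subset; Nonempty; _∩_; _∪_; ⊤; ⊥)
  renaming (_∈_ to _∈ˢ_)
open import Data.Fin.Subset.Properties using (x∈p∩q⁺; ∉⊥)
open import Data.List.Base using (List; length; map; filter; allFin; sum)
open import Data.List.Membership.Propositional using (_∈_)
open import Data.List.Relation.Unary.Any using (here; there)
open import Data.Nat.Base using (ℕ; _+_; _≤_; _<_; _/_; NonZero)
open import Data.Product.Base using (∃-syntax; Σ-syntax; _×_; _,_; proj₁; proj₂)
open import Data.Sum.Base using ([_,_]′; _⊎_; inj₁; inj₂)
open import Level using (0ℓ)
open import Relation.Binary.Construct.Closure.ReflexiveTransitive using (Star)
open import Relation.Binary.Construct.Closure.Symmetric using (SymClosure; fwd; bwd)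
open import Relation.Binary.Construct.Closure.Transitive using (TransClosure; [_]; _∷_)
open import Relation.Binary.Core using (Rel)
open import Relation.Binary.Definitions using (Decidable)
open import Relation.Binary.PropositionalEquality using (_≡_; subst)
open import Relation.Nullary.Decidable.Core using (map′; _⊎-dec_)
open import Relation.Nullary.Negation.Core using (¬_)
open import Relation.Unary using (Pred)

record Digraph (n : ℕ) : Set₁ where
  field
    Arc  : Rel (Fin n) 0ℓ
    arc? : Decidable Arc

  Adjacent : Rel (Fin n) 0ℓ
  Adjacent = SymClosure Arc

  adjacent? : Decidable Adjacent
  adjacent? u v = map′ [ fwd , bwd ]′ to⊎ (arc? u v ⊎-dec arc? v u)
    where
    to⊎ : Adjacent u v → Arc u v ⊎ Arc v u
    to⊎ (fwd a) = inj₁ a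
    to⊎ (bwd a) = inj₂ a

  -- Duplicate-free, because allFin n is; so length (N v) is the number of
  -- neighbours, and a neighbour joined by arcs both ways would count once.
  N : Fin n → List (Fin n)
  N v = filter (adjacent? v) (allFin n)

  d : Fin n → ℕ
  d v = length (N v)

  S : (Fin n → ℕ) → Fin n → ℕ
  S f v = sum (map f (N v))

  Acyclic : Set
  Acyclic = ∀ v → ¬ TransClosure Arc v v

  Connected : Set
  Connected = ∀ u v → Star Adjacent u v

module _ {n : ℕ} (D : Digraph n) where
  open Digraph D

  record IsMonotoneBipartition (V₁ V₂ : Subset n) : Set where
    field
      nonempty₁ : Nonempty V₁
      nonempty₂ : Nonempty V₂
      disjoint  : V₁ ∩ V₂ ≡ ⊥
      cover     : V₁ ∪ V₂ ≡ ⊤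
      monotone  : ∀ {u v} → Arc u v → u ∈ˢ V₁ × v ∈ˢ V₂

  -- Topological additive numberings are a notion for acyclic digraphs. The
  -- definitions below make sense for every digraph; this lemma shows that
  -- monotone bipartite digraphs need no separate acyclicity hypothesis.
  monotoneBipartition⇒acyclic : ∀ {V₁ V₂} → IsMonotoneBipartition V₁ V₂ → Acyclic
  monotoneBipartition⇒acyclic {V₁} {V₂} B v c =
    ∉⊥ (subst (v ∈ˢ_) disjoint (x∈p∩q⁺ (source c , target c)))
    where
    open IsMonotoneBipartition B

    source : ∀ {x y} → TransClosure Arc x y → x ∈ˢ V₁
    source [ a ]   = proj₁ (monotone a)
    source (a ∷ _) = proj₁ (monotone a)

    target : ∀ {x y} → TransClosure Arc x y → y ∈ˢ V₂
    target [ a ]   = proj₂ (monotone a)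
    target (_ ∷ c) = target c

  record IsTopologicalAdditiveNumbering (f : Fin n → ℕ) : Set where
    field
      positive   : ∀ v → 1 ≤ f v
      increasing : ∀ {u v} → Arc u v → S f u < S f v

  IsLargestLabel : (Fin n → ℕ) → ℕ → Set
  IsLargestLabel f k = (∃[ v ] f v ≡ k) × (∀ v → f v ≤ k)

  HasTopologicalAdditiveNumbering : ℕ → Set
  HasTopologicalAdditiveNumbering k =
    ∃[ f ] IsTopologicalAdditiveNumbering f × IsLargestLabel f k

IsLeast : Pred ℕ 0ℓ → Pred ℕ 0ℓ
IsLeast P k = P k × (∀ j → P j → k ≤ j)

IsGreatest : Pred ℕ 0ℓ → Pred ℕ 0ℓ
IsGreatest P k = P k × (∀ j → P j → j ≤ k)

-- ηₜ is partial, so it is given by its graph: ηₜ D k says that the number is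
-- defined for D and equals k.
ηₜ : ∀ {n} → Digraph n → Pred ℕ 0ℓ
ηₜ D = IsLeast (HasTopologicalAdditiveNumbering D)

∈⇒length-nonZero : ∀ {A : Set} {x : A} {xs : List A} → x ∈ xs → NonZero (length xs)
∈⇒length-nonZero (here _)  = _
∈⇒length-nonZero (there _) = _

-- The set { ⌊d(u)/d(v)⌋ + 1 : v ∈ V₂, u ∈ N(v) }; the divisor is nonzero
-- because u ∈ N(v).
DegreeRatio : ∀ {n} → Digraph n → Subset n → Pred ℕ 0ℓ
DegreeRatio D V₂ k =
  ∃[ v ] v ∈ˢ V₂ × ∃[ u ] Σ[ u∈Nv ∈ u ∈ N v ]
    k ≡ _/_ (d u) (d v) {{∈⇒length-nonZero u∈Nv}} + 1
  where open Digraph D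

-- Label V₁ by k and V₂ by 1. An arc (u , v) then has S(u) = d(u) and
-- S(v) = k d(v), so the labeling is a numbering as soon as d(u) < k d(v), that
-- is ⌊d(u)/d(v)⌋ + 1 ≤ k, for every arc. Conversely a numbering with largest
-- label j gives d(u) ≤ S(u) < S(v) ≤ j d(v), hence the same condition on j.
module Submission where

open import Defs
open import Data.Fin.Base using (Fin)
open import Data.Fin.Subset using (Subset)
  renaming (_∈_ to _∈ˢ_)
open import Data.Fin.Subset.Properties using (_∈?_; x∈p∩q⁺; ∉⊥)
open import Data.List.Base using (List; []; _∷_; length; map; filter; allFin; cartesianProduct)
open import Data.List.Extrema.Nat using (argmax; argmax-all; f[xs]≤f[argmax])
open import Data.List.Membership.Propositional using (_∈_)
open import Data.List.Membership.Propositional.Properties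
  using (∈-allFin; ∈-filter⁺; ∈-filter⁻; ∈-cartesianProduct⁺)
open import Data.List.Relation.Unary.All using (lookup)
open import Data.List.Relation.Unary.All.Properties using (all-filter)
open import Data.List.Relation.Unary.Any using (here; there)
open import Data.Nat.Base using (ℕ; suc; pred; _+_; _*_; _/_; _%_; _≤_; _<_; z≤n; NonZero)
open import Data.Nat.ListAction using (sum)
open import Data.Nat.DivMod using (/-congʳ; m≡m%n+[m/n]*n; m%n<n; m<n*o⇒m/o<n)
open import Data.Nat.Properties
open import Data.Product.Base using (_×_; _,_; ∃-syntax; proj₁; proj₂; uncurry)
open import Function.Base using (_∘_)
open import Relation.Binary.Construct.Closure.ReflexiveTransitive using (ε; _◅_)
open import Relation.Binary.Construct.Closure.Symmetric using (fwd; bwd)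
open import Relation.Binary.PropositionalEquality using (_≡_; refl; sym; cong; subst)
open import Relation.Nullary using (¬_; yes; no; contradiction)

-- The remainder is below `o`, so `m` lies strictly below the next multiple of `o` after
-- `m / o * o`. With the converse that follows, this turns bounds on floors into division-free
-- inequalities.
m/o+1≤n⇒m<n*o : ∀ m {n} o .{{_ : NonZero o}} → m / o + 1 ≤ n → m < n * o
m/o+1≤n⇒m<n*o m {n} o q+1≤n = begin-strict
  m                  ≡⟨ m≡m%n+[m/n]*n m o ⟩
  m % o + m / o * o  <⟨ +-monoˡ-< (m / o * o) (m%n<n m o) ⟩
  suc (m / o) * o    ≡⟨ cong (_* o) (+-comm 1 (m / o)) ⟩
  (m / o + 1) * o    ≤⟨ *-monoˡ-≤ o q+1≤n ⟩
  n * o              ∎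
  where open ≤-Reasoning

m<n*o⇒m/o+1≤n : ∀ m {n} o .{{_ : NonZero o}} → m < n * o → m / o + 1 ≤ n
m<n*o⇒m/o+1≤n m {n} o m<n*o =
  subst (_≤ n) (+-comm 1 (m / o)) (m<n*o⇒m/o<n {m} {n} {o} m<n*o)

module _ {A : Set} (f : A → ℕ) (c : ℕ) where

  sum-map≤ : ∀ xs → (∀ {x} → x ∈ xs → f x ≤ c) → sum (map f xs) ≤ c * length xs
  sum-map≤ []       _ = z≤n
  sum-map≤ (x ∷ xs) h = subst (sum (map f (x ∷ xs)) ≤_) (sym (*-suc c (length xs)))
    (+-mono-≤ (h (here refl)) (sum-map≤ xs (h ∘ there)))

  sum-map≥ : ∀ xs → (∀ {x} → x ∈ xs → c ≤ f x) → c * length xs ≤ sum (map f xs)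
  sum-map≥ []       _ = ≤-reflexive (*-zeroʳ c)
  sum-map≥ (x ∷ xs) h = subst (_≤ sum (map f (x ∷ xs))) (sym (*-suc c (length xs)))
    (+-mono-≤ (h (here refl)) (sum-map≥ xs (h ∘ there)))

module _ {n : ℕ} (D : Digraph n) where
  open Digraph D

  arc⇒∈N : ∀ {u v} → Arc u v → u ∈ N v
  arc⇒∈N {u} {v} a = ∈-filter⁺ (adjacent? v) (∈-allFin u) (bwd a)

  ∈N⇒adjacent : ∀ {u v} → u ∈ N v → Adjacent v u
  ∈N⇒adjacent {v = v} = proj₂ ∘ ∈-filter⁻ (adjacent? v) {xs = allFin n}

  -- The divisor agrees with d v when v has a neighbour, and makes the ratio
  -- total, so that it can be maximised over a list of pairs.
  ratio : Fin n × Fin n → ℕ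
  ratio (u , v) = d u / suc (pred (d v)) + 1

  ratio-/ : ∀ u v .{{_ : NonZero (d v)}} → ratio (u , v) ≡ d u / d v + 1
  ratio-/ u v = cong (_+ 1) (/-congʳ {m = d u} (suc-pred (d v)))

  ratio≤⇒d<* : ∀ {u v j} → Arc u v → ratio (u , v) ≤ j → d u < j * d v
  ratio≤⇒d<* {u} {v} {j} a r≤j =
    m/o+1≤n⇒m<n*o (d u) (d v) (subst (_≤ j) (ratio-/ u v) r≤j)
    where instance _ = ∈⇒length-nonZero (arc⇒∈N a)

  d<*⇒ratio≤ : ∀ {u v j} → Arc u v → d u < j * d v → ratio (u , v) ≤ j
  d<*⇒ratio≤ {u} {v} {j} a d<jd =
    subst (_≤ j) (sym (ratio-/ u v)) (m<n*o⇒m/o+1≤n (d u) (d v) d<jd)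
    where instance _ = ∈⇒length-nonZero (arc⇒∈N a)

  ratio-maximal-arc : ∀ {u v} → Arc u v →
    ∃[ x ] ∃[ y ] Arc x y × (∀ {u v} → Arc u v → ratio (u , v) ≤ ratio (x , y))
  ratio-maximal-arc {u} {v} a =
    _ , _ ,
    -- The given arc is the default value of `argmax`, so the maximiser is an arc, just as every
    -- pair kept by the filter is.
    argmax-all ratio {P = uncurry Arc} a (all-filter (uncurry arc?) pairs) ,
    λ {u′} {v′} a′ → lookup (f[xs]≤f[argmax] {f = ratio} (u , v) arcs)
      (∈-filter⁺ (uncurry arc?) (∈-cartesianProduct⁺ (∈-allFin u′) (∈-allFin v′)) a′)
    where
    pairs arcs : List (Fin n × Fin n)
    pairs = cartesianProduct (allFin n) (allFin n)
    arcs  = filter (uncurry arc?) pairs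

  -- This is the lower bound on every admissible `j`; applied to an arc of maximal ratio it yields
  -- minimality in `ηₜ`.
  numbering⇒ratio≤ : ∀ {j u v} → HasTopologicalAdditiveNumbering D j →
    Arc u v → ratio (u , v) ≤ j
  numbering⇒ratio≤ {j} {u} {v} (f , numbering , _ , f≤j) a = d<*⇒ratio≤ a (begin-strict
    d u      ≡⟨ sym (*-identityˡ (d u)) ⟩
    1 * d u  ≤⟨ sum-map≥ f 1 (N u) (λ {w} _ → positive w) ⟩
    S f u    <⟨ increasing a ⟩
    S f v    ≤⟨ sum-map≤ f j (N v) (λ {w} _ → f≤j w) ⟩
    j * d v  ∎)
    where
    open IsTopologicalAdditiveNumbering numbering
    open ≤-Reasoning

  module _ {V₁ V₂ : Subset n} (B : IsMonotoneBipartition D V₁ V₂) where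
    open IsMonotoneBipartition B

    V₁∌V₂ : ∀ {v} → v ∈ˢ V₂ → ¬ v ∈ˢ V₁
    V₁∌V₂ {v} v∈V₂ v∈V₁ = ∉⊥ (subst (v ∈ˢ_) disjoint (x∈p∩q⁺ (v∈V₁ , v∈V₂)))

    -- A walk from `V₁` to `V₂` cannot be empty, since the parts are disjoint, and its first step is
    -- an arc read in one of the two directions. This arc makes the maximum range over a nonempty
    -- set.
    connected⇒arc : Connected → ∃[ u ] ∃[ v ] Arc u v
    connected⇒arc conn with nonempty₁ | nonempty₂
    ... | s , s∈V₁ | t , t∈V₂ with conn s t
    ...   | ε         = contradiction s∈V₁ (V₁∌V₂ t∈V₂)
    ...   | fwd a ◅ _ = _ , _ , a
    ...   | bwd a ◅ _ = _ , _ , a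

    arc⇒DegreeRatio : ∀ {u v} → Arc u v → DegreeRatio D V₂ (ratio (u , v))
    arc⇒DegreeRatio {u} {v} a = v , proj₂ (monotone a) , u , arc⇒∈N a , ratio-/ u v
      where instance _ = ∈⇒length-nonZero (arc⇒∈N a)

    -- An arc leaving `v` would put `v` in `V₁`, so the edge between `v` and `u` is directed towards
    -- `v`. Hence the ratios in the theorem are exactly those taken over arcs.
    DegreeRatio⇒arc : ∀ {k} → DegreeRatio D V₂ k →
      ∃[ u ] ∃[ v ] Arc u v × k ≡ ratio (u , v)
    DegreeRatio⇒arc (v , v∈V₂ , u , u∈Nv , refl) with ∈N⇒adjacent u∈Nv
    ... | fwd a = contradiction (proj₁ (monotone a)) (V₁∌V₂ v∈V₂)
    ... | bwd a = u , v , a , sym (ratio-/ u v)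
      where instance _ = ∈⇒length-nonZero u∈Nv

    -- The conclusion is stated as non-membership in `V₁` because `label` decides only membership in
    -- `V₁`.
    neighbour-of-V₁ : ∀ {v w} → v ∈ˢ V₁ → w ∈ N v → ¬ w ∈ˢ V₁
    neighbour-of-V₁ v∈V₁ w∈Nv with ∈N⇒adjacent w∈Nv
    ... | fwd a = V₁∌V₂ (proj₂ (monotone a))
    ... | bwd a = contradiction v∈V₁ (V₁∌V₂ (proj₂ (monotone a)))

    neighbour-of-V₂ : ∀ {v w} → v ∈ˢ V₂ → w ∈ N v → w ∈ˢ V₁
    neighbour-of-V₂ v∈V₂ w∈Nv with ∈N⇒adjacent w∈Nv
    ... | fwd a = contradiction (proj₁ (monotone a)) (V₁∌V₂ v∈V₂)
    ... | bwd a = proj₁ (monotone a)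

    module _ {k : ℕ} (1≤k : 1 ≤ k) where

      label : Fin n → ℕ
      label v with v ∈? V₁
      ... | yes _ = k
      ... | no  _ = 1

      label-∈ : ∀ {v} → v ∈ˢ V₁ → label v ≡ k
      label-∈ {v} v∈V₁ with v ∈? V₁
      ... | yes _    = refl
      ... | no  v∉V₁ = contradiction v∈V₁ v∉V₁

      label-∉ : ∀ {v} → ¬ v ∈ˢ V₁ → label v ≡ 1
      label-∉ {v} v∉V₁ with v ∈? V₁
      ... | yes v∈V₁ = contradiction v∈V₁ v∉V₁
      ... | no  _    = refl

      1≤label : ∀ v → 1 ≤ label v
      1≤label v with v ∈? V₁
      ... | yes _ = 1≤k
      ... | no  _ = ≤-refl

      label≤k : ∀ v → label v ≤ k
      label≤k v with v ∈? V₁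
      ... | yes _ = ≤-refl
      ... | no  _ = 1≤k

      label-increasing : (∀ {u v} → Arc u v → ratio (u , v) ≤ k) →
        ∀ {u v} → Arc u v → S label u < S label v
      label-increasing ratio≤k {u} {v} a = begin-strict
        S label u  ≤⟨ sum-map≤ label 1 (N u)
                        (≤-reflexive ∘ label-∉ ∘ neighbour-of-V₁ (proj₁ (monotone a))) ⟩
        1 * d u    ≡⟨ *-identityˡ (d u) ⟩
        d u        <⟨ ratio≤⇒d<* a (ratio≤k a) ⟩
        k * d v    ≤⟨ sum-map≥ label k (N v)
                        (≤-reflexive ∘ sym ∘ label-∈ ∘ neighbour-of-V₂ (proj₂ (monotone a))) ⟩
        S label v  ∎
        where open ≤-Reasoning

      ratio≤⇒numbering : (∀ {u v} → Arc u v → ratio (u , v) ≤ k) →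
        HasTopologicalAdditiveNumbering D k
      ratio≤⇒numbering ratio≤k =
        label ,
        record { positive = 1≤label ; increasing = label-increasing ratio≤k } ,
        -- A vertex of `V₁` attains `k`, so `k` is the largest label and not merely a bound.
        (proj₁ nonempty₁ , label-∈ (proj₂ nonempty₁)) ,
        label≤k

    maximal⇒ηₜ×greatest : ∀ {x y} → Arc x y →
      (∀ {u v} → Arc u v → ratio (u , v) ≤ ratio (x , y)) →
      ηₜ D (ratio (x , y)) × IsGreatest (DegreeRatio D V₂) (ratio (x , y))
    maximal⇒ηₜ×greatest {x} {y} xy maximal =
      -- Every ratio ends in `+ 1`, so it is at least 1 and can serve as a label. Minimality uses
      -- only the single arc `xy`.
      (ratio≤⇒numbering (m≤n+m 1 _) maximal , λ j num → numbering⇒ratio≤ num xy) ,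
      arc⇒DegreeRatio xy ,
      upperBound
      where
      upperBound : ∀ j → DegreeRatio D V₂ j → j ≤ ratio (x , y)
      upperBound j j∈ with DegreeRatio⇒arc j∈
      ... | _ , _ , a , refl = maximal a

proposition4 : (n : ℕ) (D : Digraph n) (V₁ V₂ : Subset n) →
    IsMonotoneBipartition D V₁ V₂ → Digraph.Connected D →
    ∃[ k ] (ηₜ D k × IsGreatest (DegreeRatio D V₂) k)
proposition4 n D V₁ V₂ B conn =
  let _ , _ , a            = connected⇒arc D B conn
      x , y , xy , maximal = ratio-maximal-arc D a
  in ratio D (x , y) , maximal⇒ηₜ×greatest D B xy maximal
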